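{- Let $C_k=\frac1{k+1}\binom{2k}{k}$ denote the Catalan numbers, put $\gamma(k)=(2k)!/(4^{k}\,k!)$ for integers $k\ge0$, and define $$\Lambda_N(t)=\prod_{j=1}^{N-1}(t+j)_j\qquad(\Lambda_0=\Lambda_1=1).$$ Let $N\ge0$ and let $a,b$ be integers with $a\ge N-1$, $a\ge 0$ and $b\ge a+1$. Then $$\det\bigl(C_{a+r-m}\,C_{b+r+m}\bigr)_{0\le r,m\le N-1} =(-4)^{\binom N2}\,4^{\,N(a+b)}\,\prod_{k=1}^{N-1}(2k+1)!\;\cdot\; \frac{\displaystyle\prod_{k=0}^{N-1}\gamma(a-k)\,\gamma(b+k)} {\displaystyle\prod_{k=2}^{N+1}(a+k-1)!\;\prod_{k=N+1}^{2N}(b+k-1)!}\; \Lambda_N(b-a)\,\Lambda_N\bigl(a+b+\tfrac32\bigr).$$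
   Context: $(u)_j=u(u+1)\cdots(u+j-1)$ is the Pochhammer symbol; empty products and the determinant of the empty ($0\times0$) matrix equal $1$. -}

module Defs where

open import Data.Fin.Base using (Fin; zero; suc; toℕ; punchIn)
open import Data.Integer.Base using (+_)
open import Data.Nat.Base as ℕ using (ℕ; zero; suc; _!)
open import Data.Nat.Combinatorics using (_C_)
open import Data.Nat.Properties using (m^n≢0; m*n≢0; _!≢0)
open import Data.Rational.Base
open import Data.Rational.Properties
open import Algebra.Bundles using (CommutativeRing)

open import Algebra.Properties.CommutativeMonoid.Sum +-0-commutativeMonoid public
  using (sum-syntax)
open import Algebra.Properties.CommutativeMonoid.Sum *-1-commutativeMonoid public
  using () renaming (sum to product)
open import Algebra.Properties.Semiring.Exp
  (CommutativeRing.semiring +-*-commutativeRing) public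
  using (_^_)

fromℕ : ℕ → ℚ
fromℕ n = + n / 1

-- Half-open range lo ≤ k < hi: with a closed range and truncated subtraction,
-- the empty product over 0 ≤ k ≤ N - 1 at N = 0 would acquire a factor.
∏-syntax : ℕ → ℕ → (ℕ → ℚ) → ℚ
∏-syntax lo hi f = product {hi ℕ.∸ lo} (λ i → f (lo ℕ.+ toℕ i))

infix 10 ∏-syntax
syntax ∏-syntax lo hi (λ k → x) = ∏[ lo ≤ k < hi ] x

-- Laplace expansion along the first row.
det : ∀ {n} → (Fin n → Fin n → ℚ) → ℚ
det {zero}  A = 1ℚ
det {suc n} A =
  ∑[ j < suc n ] ((- 1ℚ) ^ toℕ j * A zero j * det (λ r m → A (suc r) (punchIn j m)))

catalan : ℕ → ℚ
catalan k = + ((2 ℕ.* k) C k) / suc k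

γ : ℕ → ℚ
γ k = (+ ((2 ℕ.* k) !) / (4 ℕ.^ k ℕ.* k !))
  {{m*n≢0 (4 ℕ.^ k) (k !) {{m^n≢0 4 k}} {{k !≢0}}}}

pochhammer : ℚ → ℕ → ℚ
pochhammer u j = ∏[ 0 ≤ i < j ] (u + fromℕ i)

Λ : ℕ → ℚ → ℚ
Λ N t = ∏[ 1 ≤ j < N ] pochhammer (t + fromℕ j) j

∏!-positive : ∀ lo hi (s : ℕ → ℕ) → Positive (∏[ lo ≤ k < hi ] fromℕ (s k !))
∏!-positive lo hi s = go (hi ℕ.∸ lo) (λ i → s (lo ℕ.+ toℕ i))
  where
  go : ∀ n (t : Fin n → ℕ) → Positive (product (λ i → fromℕ (t i !)))
  go zero    t = _
  go (suc n) t = pos*pos⇒pos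
    (fromℕ (t zero !)) {{normalize-pos (t zero !) 1 {{_}} {{t zero !≢0}}}}
    (product (λ i → fromℕ (t (suc i) !))) {{go n (λ i → t (suc i))}}

∏!*∏!-nonZero : ∀ lo hi (s : ℕ → ℕ) lo′ hi′ (s′ : ℕ → ℕ) →
  NonZero ((∏[ lo ≤ k < hi ] fromℕ (s k !)) * (∏[ lo′ ≤ k < hi′ ] fromℕ (s′ k !)))
∏!*∏!-nonZero lo hi s lo′ hi′ s′ = pos⇒nonZero (P * Q)
  {{pos*pos⇒pos P {{∏!-positive lo hi s}} Q {{∏!-positive lo′ hi′ s′}}}}
  where
  P = ∏[ lo ≤ k < hi ] fromℕ (s k !)
  Q = ∏[ lo′ ≤ k < hi′ ] fromℕ (s′ k !)

{-# OPTIONS --safe #-}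
module Submission where

-- Since Cₖ (k+1)! = 4ᵏ γ(k) and γ(k+1) = (k + ½) γ(k), clearing denominators turns the entry (r, m) into a row
-- factor times a column factor times ∏_{i<r} (Xₘ + Aᵢ) ∏_{r≤i<N-1} (Xₘ + Bᵢ) with Xₘ = (a - m)(b + m). The
-- determinant of such a matrix is ∏_{l<m} (Xₘ - Xₗ) ∏_{i≤j} (Bⱼ - Aᵢ) (Krattenthaler), which follows from Laplace
-- expansion and Lagrange interpolation. Here Xₘ - Xₗ = -(m - l)(b - a + l + m) and
-- Bⱼ - Aᵢ = (j - i + 3/2)(a + b + 3/2 + i + j + 1), which yields the two Λ factors.

open import Defs
open import Algebra.Bundles using (CommutativeRing)
open import Data.Fin.Base using (Fin; zero; suc; toℕ; punchIn)
open import Data.Fin.Permutation using (reverse)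
open import Data.Fin.Properties using (toℕ-inject₁; toℕ-fromℕ; opposite-prop; toℕ<n)
open import Data.Integer.Base using (+_)
import Data.Integer.Base as ℤ
import Data.Integer.Properties as ℤ
open import Data.Nat.Base as ℕ using (ℕ; zero; suc; _!; z≤n; s≤s)
open import Data.Nat.Combinatorics
  using (_C_; nCk≡n!/k![n-k]!; k![n∸k]!∣n!; nCk+nC[k+1]≡[n+1]C[k+1]; nC1≡n)
open import Data.Nat.DivMod using (m/n*n≡m)
import Data.Nat.Properties as ℕ
open import Data.Nat.Tactic.RingSolver using (solve-∀)
open import Data.Rational.Base using (ℚ; 0ℚ; 1ℚ; ½; _+_; _-_; _*_; -_; _/_; _÷_; 1/_; NonZero; toℚᵘ)
open import Data.Rational.Properties
open import Data.Rational.Solver using (module +-*-Solver)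
import Data.Rational.Unnormalised.Base as ℚᵘ
import Data.Rational.Unnormalised.Properties as ℚᵘ
open import Algebra.Properties.CommutativeMonoid.Sum +-0-commutativeMonoid as Sum using (sum)
import Algebra.Properties.CommutativeMonoid.Sum *-1-commutativeMonoid as Prod
open import Algebra.Properties.Semiring.Exp
  (CommutativeRing.semiring +-*-commutativeRing) using (^-homo-*; ^-assocʳ)
open import Algebra.Properties.Semiring.Sum
  (CommutativeRing.semiring +-*-commutativeRing) using (*-distribˡ-sum)
open import Function.Base using (_∘_)
open import Relation.Binary.PropositionalEquality
  using (_≡_; refl; sym; trans; cong; cong₂; subst; module ≡-Reasoning)
open +-*-Solver using (solve; _:=_; _:+_; _:-_; _:*_; :-_; con)
open ≡-Reasoning

-- Put n = N - 1. Multiplying `catalan (k + r)` by (k + r + 1)! alone would leave a factor that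
-- mixes the row with the column. The factorial (k + n + 1)! serves all rows at once: it depends on
-- the column only, and its surplus (k + r + 2) ... (k + n + 1) supplies polynomial factors with
-- offsets i + 2, while the growth of `γ` over r steps supplies those with offsets i + ½. Used at k
-- = a - m and at k = b + m, whose sum is fixed, equal offsets pair up into a function of the single
-- node X_m. The number 3/2 is the gap 2 - ½ between the two families of offsets. Interpolation and
-- the determinant evaluation are kept as polynomial identities in the nodes, and the product of all
-- column factorials is divided out once, at the very end. The constants combine level by level: row
-- r carries 16^r, the Vandermonde differences give (-1)^r r!, the differences of offsets give
-- (3/2)_r, and the product of these three is (-4)^r (2r+1)!.

sum-linear : ∀ {n} c d (f g : Fin n → ℚ) →
  ∑[ j < n ] (c * f j + d * g j) ≡ c * sum f + d * sum g
sum-linear c d f g = trans (Sum.∑-distrib-+ (λ j → c * f j) (λ j → d * g j))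
  (cong₂ _+_ (sym (*-distribˡ-sum c f)) (sym (*-distribˡ-sum d g)))

-- Scaling the rows and columns of a determinant.

minor : ∀ {n} → (Fin (suc n) → Fin (suc n) → ℚ) → Fin (suc n) → Fin n → Fin n → ℚ
minor A j r m = A (suc r) (punchIn j m)

det-cong : ∀ {n} {A B : Fin n → Fin n → ℚ} → (∀ r m → A r m ≡ B r m) → det A ≡ det B
det-cong {zero}  eq = refl
det-cong {suc n} eq = Sum.sum-cong-≗ λ j →
  cong₂ _*_ (cong ((- 1ℚ) ^ toℕ j *_) (eq zero j)) (det-cong λ r m → eq (suc r) (punchIn j m))

-- In the Laplace term of column `j` the entry contributes `c j` and the minor contributes the
-- scalars of all other columns, so every term carries the full product.
det-scaleCols : ∀ {n} (c : Fin n → ℚ) (A : Fin n → Fin n → ℚ) →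
  det (λ r m → c m * A r m) ≡ product c * det A
det-scaleCols {zero}  c A = refl
det-scaleCols {suc n} c A = trans (Sum.sum-cong-≗ term)
  (sym (*-distribˡ-sum (product c) (λ j → (- 1ℚ) ^ toℕ j * A zero j * det (minor A j))))
  where
  term : ∀ j → _
  term j = begin
    ε * (c j * A zero j) * det (λ r m → c (punchIn j m) * M r m)
      ≡⟨ cong (ε * (c j * A zero j) *_) (det-scaleCols (c ∘ punchIn j) M) ⟩
    ε * (c j * A zero j) * (product (c ∘ punchIn j) * det M)
      ≡⟨ solve 5 (λ e c a p d → e :* (c :* a) :* (p :* d) := (c :* p) :* (e :* a :* d)) refl
           ε (c j) (A zero j) (product (c ∘ punchIn j)) (det M) ⟩
    c j * product (c ∘ punchIn j) * (ε * A zero j * det M)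
      ≡⟨ cong (_* (ε * A zero j * det M)) (Prod.sum-remove {i = j} c) ⟨
    product c * (ε * A zero j * det M) ∎
    where
    ε = (- 1ℚ) ^ toℕ j
    M = minor A j

det-scaleRows : ∀ {n} (u : Fin n → ℚ) (A : Fin n → Fin n → ℚ) →
  det (λ r m → u r * A r m) ≡ product u * det A
det-scaleRows {zero}  u A = refl
det-scaleRows {suc n} u A = trans (Sum.sum-cong-≗ term)
  (sym (*-distribˡ-sum (product u) (λ j → (- 1ℚ) ^ toℕ j * A zero j * det (minor A j))))
  where
  term : ∀ j → _
  term j = trans
    (cong ((- 1ℚ) ^ toℕ j * (u zero * A zero j) *_)
      (det-scaleRows (u ∘ suc) (minor A j)))
    (solve 5 (λ e c a p d → e :* (c :* a) :* (p :* d) := (c :* p) :* (e :* a :* d)) refl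
      ((- 1ℚ) ^ toℕ j) (u zero) (A zero j) (product (u ∘ suc)) (det (minor A j)))

-- Lagrange interpolation without division.

vandermonde : ∀ {n} → (Fin n → ℚ) → ℚ
vandermonde {zero}  X = 1ℚ
vandermonde {suc n} X = product (λ m → X (suc m) - X zero) * vandermonde (X ∘ suc)

linearProduct : (ℕ → ℚ) → ℕ → ℚ → ℚ
linearProduct B k x = ∏[ 0 ≤ i < k ] (x + B i)

-- For distinct nodes this is `vandermonde X` times the value at `t` of the polynomial interpolating
-- `P`: up to the sign (-1)^j, leaving out node j divides the Vandermonde product by ∏_{m≠j} (X_m -
-- X_j), the denominator of the j-th Lagrange basis polynomial. The signs are those of a Laplace
-- expansion.
lagrangeSum : ∀ {n} → (ℚ → ℚ) → (Fin (suc n) → ℚ) → ℚ → ℚ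
lagrangeSum {n} P X t = ∑[ j < suc n ]
  ((- 1ℚ) ^ toℕ j * P (X j) * (product (λ m → X (punchIn j m) - t) * vandermonde (X ∘ punchIn j)))

-- The Lagrange basis polynomials sum to 1. By induction on the nodes, the terms after the first
-- split into shorter sums evaluated at `t` and at `X zero`; both equal `V`, and the part with `Πt`
-- cancels the term of node 0.
lagrangeSum-one : ∀ {n} (X : Fin (suc n) → ℚ) t → lagrangeSum (λ _ → 1ℚ) X t ≡ vandermonde X
lagrangeSum-one {zero}  X t = refl
lagrangeSum-one {suc n} X t = begin
  1ℚ * 1ℚ * (Πt * V) + sum (λ j → f (suc j))
    ≡⟨ cong (λ u → 1ℚ * 1ℚ * (Πt * V) + u) (Sum.sum-cong-≗ term) ⟩
  1ℚ * 1ℚ * (Πt * V) + ∑[ j < suc n ] (Πz * g t j + - Πt * g z j)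
    ≡⟨ cong (λ u → 1ℚ * 1ℚ * (Πt * V) + u) (sum-linear Πz (- Πt) (g t) (g z)) ⟩
  1ℚ * 1ℚ * (Πt * V) + (Πz * lagrangeSum (λ _ → 1ℚ) W t + - Πt * lagrangeSum (λ _ → 1ℚ) W z)
    ≡⟨ cong₂ (λ u v → 1ℚ * 1ℚ * (Πt * V) + (Πz * u + - Πt * v)) (lagrangeSum-one W t) (lagrangeSum-one W z) ⟩
  1ℚ * 1ℚ * (Πt * V) + (Πz * V + - Πt * V)
    ≡⟨ solve 3 (λ p q v → con 1ℚ :* con 1ℚ :* (p :* v) :+ (q :* v :+ :- p :* v) := q :* v) refl Πt Πz V ⟩
  Πz * V ∎
  where
  z = X zero
  W = X ∘ suc
  V = vandermonde W
  Π : ℚ → ℚ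
  Π u = product (λ m → W m - u)
  Πt = Π t
  Πz = Π z
  f : Fin (suc (suc n)) → ℚ
  f j = (- 1ℚ) ^ toℕ j * 1ℚ * (product (λ m → X (punchIn j m) - t) * vandermonde (X ∘ punchIn j))
  g : ℚ → Fin (suc n) → ℚ
  g u j = (- 1ℚ) ^ toℕ j * 1ℚ * (product (λ m → W (punchIn j m) - u) * vandermonde (W ∘ punchIn j))
  -- z − t = (wⱼ − t) − (wⱼ − z) completes one of the two products over m ≠ j in each summand.
  term : ∀ j → f (suc j) ≡ Πz * g t j + - Πt * g z j
  term j = begin
    (- 1ℚ * ε) * 1ℚ * ((z - t) * pt * (pz * v))
      ≡⟨ solve 7 (λ e z t w p q v →
           (:- con 1ℚ :* e) :* con 1ℚ :* ((z :- t) :* p :* (q :* v)) :=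
           ((w :- z) :* q) :* (e :* con 1ℚ :* (p :* v)) :+ :- ((w :- t) :* p) :* (e :* con 1ℚ :* (q :* v)))
           refl ε z t (W j) pt pz v ⟩
    (W j - z) * pz * g t j + - ((W j - t) * pt) * g z j
      ≡⟨ cong₂ (λ p q → p * g t j + - q * g z j)
           (Prod.sum-remove {i = j} (λ m → W m - z)) (Prod.sum-remove {i = j} (λ m → W m - t)) ⟨
    Πz * g t j + - Πt * g z j ∎
    where
    ε = (- 1ℚ) ^ toℕ j
    pt = product (λ m → W (punchIn j m) - t)
    pz = product (λ m → W (punchIn j m) - z)
    v = vandermonde (W ∘ punchIn j)

-- Lagrange interpolation at the nodes X, cleared of denominators.
lagrangeSum-linearProduct : ∀ {k n} → k ℕ.≤ n → ∀ B (X : Fin (suc n) → ℚ) t →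
  lagrangeSum (linearProduct B k) X t ≡ linearProduct B k t * vandermonde X
lagrangeSum-linearProduct {zero} _ B X t = trans (lagrangeSum-one X t) (sym (*-identityˡ _))
lagrangeSum-linearProduct {suc k} {suc n} (ℕ.s≤s k≤n) B X t = begin
  lagrangeSum (linearProduct B (suc k)) X t
    ≡⟨ Sum.sum-cong-≗ term ⟩
  ∑[ j < suc (suc n) ] (Πt * g j + (t + B 0) * f j)
    ≡⟨ sum-linear Πt (t + B 0) g f ⟩
  Πt * sum g + (t + B 0) * lagrangeSum Q X t
    ≡⟨ cong₂ (λ u v → Πt * u + (t + B 0) * v) sum-g≡0
         (lagrangeSum-linearProduct (ℕ.m≤n⇒m≤1+n k≤n) (B ∘ suc) X t) ⟩
  Πt * 0ℚ + (t + B 0) * (Q t * vandermonde X)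
    ≡⟨ solve 4 (λ p b q v → p :* con 0ℚ :+ b :* (q :* v) := b :* q :* v) refl Πt (t + B 0) (Q t) (vandermonde X) ⟩
  (t + B 0) * Q t * vandermonde X ∎
  where
  Q = linearProduct (B ∘ suc) k
  Πt = product (λ m → X m - t)
  f : Fin (suc (suc n)) → ℚ
  f j = (- 1ℚ) ^ toℕ j * Q (X j) * (product (λ m → X (punchIn j m) - t) * vandermonde (X ∘ punchIn j))
  g : Fin (suc (suc n)) → ℚ
  g j = (- 1ℚ) ^ toℕ j * Q (X j) * vandermonde (X ∘ punchIn j)
  -- Writing X_j + B_0 as (X_j - t) + (t + B_0): the first part completes the product over m ≠ j to
  -- `Πt`, the second leaves an interpolation sum of lower degree.
  term : ∀ j → _ ≡ Πt * g j + (t + B 0) * f j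
  term j = begin
    ε * ((X j + B 0) * Q (X j)) * (p * v)
      ≡⟨ solve 7 (λ e x b t q p v → e :* ((x :+ b) :* q) :* (p :* v) :=
           ((x :- t) :* p) :* (e :* q :* v) :+ (t :+ b) :* (e :* q :* (p :* v)))
           refl ε (X j) (B 0) t (Q (X j)) p v ⟩
    (X j - t) * p * g j + (t + B 0) * f j
      ≡⟨ cong (λ u → u * g j + (t + B 0) * f j) (Prod.sum-remove {i = j} (λ m → X m - t)) ⟨
    Πt * g j + (t + B 0) * f j ∎
    where
    ε = (- 1ℚ) ^ toℕ j
    p = product (λ m → X (punchIn j m) - t)
    v = vandermonde (X ∘ punchIn j)
  z = X zero
  W = X ∘ suc
  V = vandermonde W
  h : Fin (suc n) → ℚ
  h j = (- 1ℚ) ^ toℕ j * Q (W j) * (product (λ m → W (punchIn j m) - z) * vandermonde (W ∘ punchIn j))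
  -- Up to the Vandermonde factor this is a top divided difference of `Q`, which vanishes because
  -- the degree k is at most n. For j ≥ 1 the reduced Vandermonde product still contains the node
  -- `z`, so these terms form minus the interpolation sum of `Q` over `W` at `z`, and cancel the
  -- term of `z` itself.
  sum-g≡0 : sum g ≡ 0ℚ
  sum-g≡0 = begin
    1ℚ * Q z * V + sum (λ j → g (suc j))
      ≡⟨ cong (λ u → 1ℚ * Q z * V + u) (Sum.sum-cong-≗ λ j →
           solve 3 (λ e q v → (:- con 1ℚ :* e) :* q :* v := :- con 1ℚ :* (e :* q :* v)) refl
             ((- 1ℚ) ^ toℕ j) (Q (W j))
             (vandermonde (X ∘ punchIn (suc j)))) ⟩
    1ℚ * Q z * V + ∑[ j < suc n ] (- 1ℚ * h j)
      ≡⟨ cong (λ u → 1ℚ * Q z * V + u) (*-distribˡ-sum (- 1ℚ) h) ⟨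
    1ℚ * Q z * V + - 1ℚ * lagrangeSum Q W z
      ≡⟨ cong (λ u → 1ℚ * Q z * V + - 1ℚ * u) (lagrangeSum-linearProduct k≤n (B ∘ suc) W z) ⟩
    1ℚ * Q z * V + - 1ℚ * (Q z * V)
      ≡⟨ solve 2 (λ q v → con 1ℚ :* q :* v :+ :- con 1ℚ :* (q :* v) := con 0ℚ) refl (Q z) V ⟩
    0ℚ ∎

-- The determinant of mixed products.

mixedProduct : (A B : ℕ → ℚ) (k r : ℕ) → ℚ → ℚ
mixedProduct A B k       zero    x = linearProduct B k x
mixedProduct A B zero    (suc r) x = 1ℚ
-- Both sequences advance together, so that after r factors from `A` the factors from `B` start at
-- index r.
mixedProduct A B (suc k) (suc r) x = (x + A 0) * mixedProduct (A ∘ suc) (B ∘ suc) k r x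

-- This is ∏_{i≤j<n} (B_j - A_i), grouped by i in the order in which successive row expansions
-- produce the factors.
mixedFactor : (A B : ℕ → ℚ) → ℕ → ℚ
mixedFactor A B zero    = 1ℚ
mixedFactor A B (suc n) = linearProduct B (suc n) (- A 0) * mixedFactor (A ∘ suc) (B ∘ suc) n

-- Expanding along the first row, column j contributes a minor of the same shape times ∏_{m≠j} (Xₘ + A₀), so the
-- expansion is Lagrange interpolation at −A₀.
det-mixedProduct : ∀ n A B (X : Fin (suc n) → ℚ) →
  det (λ r m → mixedProduct A B n (toℕ r) (X m)) ≡ mixedFactor A B n * vandermonde X
det-mixedProduct zero    A B X = refl
det-mixedProduct (suc n) A B X = begin
  det (λ r m → mixedProduct A B (suc n) (toℕ r) (X m))
    ≡⟨ Sum.sum-cong-≗ term ⟩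
  ∑[ j < suc (suc n) ] (K * f j)
    ≡⟨ *-distribˡ-sum K f ⟨
  K * lagrangeSum P X (- A 0)
    ≡⟨ cong (K *_) (lagrangeSum-linearProduct ℕ.≤-refl B X (- A 0)) ⟩
  K * (P (- A 0) * vandermonde X)
    ≡⟨ solve 3 (λ k p v → k :* (p :* v) := p :* k :* v) refl K (P (- A 0)) (vandermonde X) ⟩
  P (- A 0) * K * vandermonde X ∎
  where
  K = mixedFactor (A ∘ suc) (B ∘ suc) n
  P = linearProduct B (suc n)
  f : Fin (suc (suc n)) → ℚ
  f j = (- 1ℚ) ^ toℕ j * P (X j) * (product (λ m → X (punchIn j m) - (- A 0)) * vandermonde (X ∘ punchIn j))
  term : ∀ j → _ ≡ K * f j
  term j = begin
    ε * P (X j) * det (λ r m → (Y m + A 0) * mixedProduct (A ∘ suc) (B ∘ suc) n (toℕ r) (Y m))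
      ≡⟨ cong (ε * P (X j) *_) (det-scaleCols (λ m → Y m + A 0)
           (λ r m → mixedProduct (A ∘ suc) (B ∘ suc) n (toℕ r) (Y m))) ⟩
    ε * P (X j) * (product (λ m → Y m + A 0) * det (λ r m → mixedProduct (A ∘ suc) (B ∘ suc) n (toℕ r) (Y m)))
      ≡⟨ cong₂ (λ u v → ε * P (X j) * (u * v))
           (Prod.sum-cong-≗ λ m → solve 2 (λ y a → y :+ a := y :- (:- a)) refl (Y m) (A 0))
           (det-mixedProduct n (A ∘ suc) (B ∘ suc) Y) ⟩
    ε * P (X j) * (product (λ m → Y m - (- A 0)) * (K * vandermonde Y))
      ≡⟨ solve 5 (λ e p q k v → e :* p :* (q :* (k :* v)) := k :* (e :* p :* (q :* v))) refl
           ε (P (X j)) (product (λ m → Y m - (- A 0))) K (vandermonde Y) ⟩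
    K * f j ∎
    where
    ε = (- 1ℚ) ^ toℕ j
    Y = X ∘ punchIn j

-- Arithmetic of natural numbers inside ℚ, and division.

fromℕ≃ : ∀ n → toℚᵘ (fromℕ n) ℚᵘ.≃ ℚᵘ.mkℚᵘ (+ n) 0
fromℕ≃ n = toℚᵘ-fromℚᵘ (ℚᵘ.mkℚᵘ (+ n) 0)

-- Normalisation by a gcd blocks computation on variables; among unnormalised rationals the claim is
-- an integer identity after cross-multiplication.
fromℕ-+ : ∀ m n → fromℕ (m ℕ.+ n) ≡ fromℕ m + fromℕ n
fromℕ-+ m n = toℚᵘ-injective
  (ℚᵘ.≃-trans (fromℕ≃ (m ℕ.+ n))
  (ℚᵘ.≃-trans (ℚᵘ.*≡* (cong (ℤ._* + 1)
      (cong₂ ℤ._+_ (sym (ℤ.*-identityʳ (+ m))) (sym (ℤ.*-identityʳ (+ n))))))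
  (ℚᵘ.≃-trans (ℚᵘ.+-cong (ℚᵘ.≃-sym (fromℕ≃ m)) (ℚᵘ.≃-sym (fromℕ≃ n)))
    (ℚᵘ.≃-sym (toℚᵘ-homo-+ (fromℕ m) (fromℕ n))))))

fromℕ-* : ∀ m n → fromℕ (m ℕ.* n) ≡ fromℕ m * fromℕ n
fromℕ-* m n = toℚᵘ-injective
  (ℚᵘ.≃-trans (fromℕ≃ (m ℕ.* n))
  (ℚᵘ.≃-trans (ℚᵘ.*≡* (cong (ℤ._* + 1) (ℤ.pos-* m n)))
  (ℚᵘ.≃-trans (ℚᵘ.*-cong (ℚᵘ.≃-sym (fromℕ≃ m)) (ℚᵘ.≃-sym (fromℕ≃ n)))
    (ℚᵘ.≃-sym (toℚᵘ-homo-* (fromℕ m) (fromℕ n))))))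

/-*-cancel : ∀ n d .{{_ : ℕ.NonZero d}} → (+ n / d) * fromℕ d ≡ fromℕ n
/-*-cancel n d@(suc d-1) = toℚᵘ-injective
  (ℚᵘ.≃-trans (toℚᵘ-homo-* (+ n / d) (fromℕ d))
  (ℚᵘ.≃-trans (ℚᵘ.*-cong (toℚᵘ-fromℚᵘ (ℚᵘ.mkℚᵘ (+ n) d-1)) (fromℕ≃ d))
  (ℚᵘ.≃-trans (ℚᵘ.*≡* (trans (ℤ.*-identityʳ _) (cong (λ e → + n ℤ.* + e) (sym (ℕ.*-identityʳ d)))))
    (ℚᵘ.≃-sym (fromℕ≃ n)))))

fromℕ-suc : ∀ n → fromℕ (suc n) ≡ 1ℚ + fromℕ n
fromℕ-suc = fromℕ-+ 1

fromℕ-∸ : ∀ {m n} → m ℕ.≤ n → fromℕ (n ℕ.∸ m) ≡ fromℕ n - fromℕ m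
fromℕ-∸ {m} {n} m≤n = begin
  fromℕ (n ℕ.∸ m)                       ≡⟨ solve 2 (λ x y → x := (x :+ y) :- y) refl (fromℕ (n ℕ.∸ m)) (fromℕ m) ⟩
  fromℕ (n ℕ.∸ m) + fromℕ m - fromℕ m   ≡⟨ cong (_- fromℕ m) (fromℕ-+ (n ℕ.∸ m) m) ⟨
  fromℕ (n ℕ.∸ m ℕ.+ m) - fromℕ m       ≡⟨ cong (λ k → fromℕ k - fromℕ m) (ℕ.m∸n+n≡m m≤n) ⟩
  fromℕ n - fromℕ m                     ∎

fromℕ-^ : ∀ m n → fromℕ (m ℕ.^ n) ≡ fromℕ m ^ n
fromℕ-^ m zero    = refl
fromℕ-^ m (suc n) = trans (fromℕ-* m (m ℕ.^ n)) (cong (fromℕ m *_) (fromℕ-^ m n))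

fromℕ-! : ∀ n → fromℕ (suc n !) ≡ fromℕ (suc n) * fromℕ (n !)
fromℕ-! n = fromℕ-* (suc n) (n !)

fromℕ-nonZero : ∀ n .{{_ : ℕ.NonZero n}} → NonZero (fromℕ n)
fromℕ-nonZero n = pos⇒nonZero (fromℕ n) {{normalize-pos n 1}}

*≡⇒≡÷ : ∀ {p r} q .{{_ : NonZero q}} → p * q ≡ r → p ≡ r ÷ q
*≡⇒≡÷ {p} {r} q pq≡r = begin
  p               ≡⟨ *-identityʳ p ⟨
  p * 1ℚ          ≡⟨ cong (p *_) (*-inverseʳ q) ⟨
  p * (q * 1/ q)  ≡⟨ *-assoc p q (1/ q) ⟨
  p * q * 1/ q    ≡⟨ cong (_* 1/ q) pq≡r ⟩
  r ÷ q           ∎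

*-cancelʳ : ∀ {p q} r .{{_ : NonZero r}} → p * r ≡ q * r → p ≡ q
*-cancelʳ r pr≡qr = trans (*≡⇒≡÷ r pr≡qr) (sym (*≡⇒≡÷ r refl))

-- Factorial forms of `γ` and of the Catalan numbers.

fromℕ-[2+2n]! : ∀ n → fromℕ ((2 ℕ.* suc n) !) ≡
  (fromℕ 2 + fromℕ 2 * fromℕ n) * ((1ℚ + fromℕ 2 * fromℕ n) * fromℕ ((2 ℕ.* n) !))
fromℕ-[2+2n]! n = begin
  fromℕ ((2 ℕ.* suc n) !)
    ≡⟨ cong (λ k → fromℕ (k !)) (ℕ.*-suc 2 n) ⟩
  fromℕ (suc (suc (2 ℕ.* n)) !)
    ≡⟨ trans (fromℕ-! (suc (2 ℕ.* n))) (cong (fromℕ (2 ℕ.+ 2 ℕ.* n) *_) (fromℕ-! (2 ℕ.* n))) ⟩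
  fromℕ (2 ℕ.+ 2 ℕ.* n) * (fromℕ (1 ℕ.+ 2 ℕ.* n) * fromℕ ((2 ℕ.* n) !))
    ≡⟨ cong₂ (λ u v → u * (v * fromℕ ((2 ℕ.* n) !))) (lem 2) (lem 1) ⟩
  (fromℕ 2 + fromℕ 2 * fromℕ n) * ((1ℚ + fromℕ 2 * fromℕ n) * fromℕ ((2 ℕ.* n) !)) ∎
  where
  lem : ∀ c → fromℕ (c ℕ.+ 2 ℕ.* n) ≡ fromℕ c + fromℕ 2 * fromℕ n
  lem c = trans (fromℕ-+ c (2 ℕ.* n)) (cong (λ u → fromℕ c + u) (fromℕ-* 2 n))

γ-! : ∀ k → γ k * (fromℕ 4 ^ k * fromℕ (k !)) ≡ fromℕ ((2 ℕ.* k) !)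
γ-! k = trans
  (cong (γ k *_) (trans (cong (_* fromℕ (k !)) (sym (fromℕ-^ 4 k))) (sym (fromℕ-* (4 ℕ.^ k) (k !)))))
  (/-*-cancel ((2 ℕ.* k) !) (4 ℕ.^ k ℕ.* k !)
    {{ℕ.m*n≢0 (4 ℕ.^ k) (k !) {{ℕ.m^n≢0 4 k}} {{k ℕ.!≢0}}}})

-- The ratio is (2k+2)(2k+1) / (4(k+1)) = k + ½, read off after multiplying by the denominator `D`
-- of `γ (suc k)`.
γ-suc : ∀ k → γ (suc k) ≡ (fromℕ k + ½) * γ k
γ-suc k = *-cancelʳ D {{D≢0}} (begin
  γ (suc k) * D
    ≡⟨ γ-! (suc k) ⟩
  fromℕ ((2 ℕ.* suc k) !)
    ≡⟨ fromℕ-[2+2n]! k ⟩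
  (fromℕ 2 + fromℕ 2 * x) * ((1ℚ + fromℕ 2 * x) * fromℕ ((2 ℕ.* k) !))
    ≡⟨ cong (λ u → (fromℕ 2 + fromℕ 2 * x) * ((1ℚ + fromℕ 2 * x) * u)) (γ-! k) ⟨
  (fromℕ 2 + fromℕ 2 * x) * ((1ℚ + fromℕ 2 * x) * (γ k * (e * f)))
    ≡⟨ solve 4 (λ x g e f →
         (con (fromℕ 2) :+ con (fromℕ 2) :* x) :* ((con 1ℚ :+ con (fromℕ 2) :* x) :* (g :* (e :* f))) :=
         (x :+ con ½) :* g :* (con (fromℕ 4) :* e :* ((con 1ℚ :+ x) :* f))) refl x (γ k) e f ⟩
  (x + ½) * γ k * (fromℕ 4 * e * ((1ℚ + x) * f))
    ≡⟨ cong (λ u → (x + ½) * γ k * (fromℕ 4 * e * u))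
         (trans (fromℕ-! k) (cong (_* f) (fromℕ-suc k))) ⟨
  (x + ½) * γ k * D ∎)
  where
  x = fromℕ k
  e = fromℕ 4 ^ k
  f = fromℕ (k !)
  D = fromℕ 4 ^ suc k * fromℕ (suc k !)
  D≢0 : NonZero D
  D≢0 = subst NonZero
    (trans (fromℕ-* (4 ℕ.^ suc k) (suc k !)) (cong (_* fromℕ (suc k !)) (fromℕ-^ 4 (suc k))))
    (fromℕ-nonZero (4 ℕ.^ suc k ℕ.* suc k !)
      {{ℕ.m*n≢0 (4 ℕ.^ suc k) (suc k !) {{ℕ.m^n≢0 4 (suc k)}} {{suc k ℕ.!≢0}}}})

2nCn*n!*n! : ∀ n → ((2 ℕ.* n) C n) ℕ.* (n ! ℕ.* n !) ≡ (2 ℕ.* n) !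
2nCn*n!*n! n = begin
  ((2 ℕ.* n) C n) ℕ.* (n ! ℕ.* n !)
    ≡⟨ cong (λ k → ((2 ℕ.* n) C n) ℕ.* (n ! ℕ.* k !)) 2n∸n≡n ⟨
  ((2 ℕ.* n) C n) ℕ.* (n ! ℕ.* (2 ℕ.* n ℕ.∸ n) !)
    ≡⟨ cong (ℕ._* (n ! ℕ.* (2 ℕ.* n ℕ.∸ n) !)) (nCk≡n!/k![n-k]! n≤2n) ⟩
  _ ≡⟨ m/n*n≡m {{_}} (k![n∸k]!∣n! n≤2n) ⟩
  (2 ℕ.* n) ! ∎
  where
  n≤2n = ℕ.m≤m+n n (n ℕ.+ 0)
  2n∸n≡n = trans (ℕ.m+n∸m≡n n (n ℕ.+ 0)) (ℕ.+-identityʳ n)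

-- Both sides are (2k)!/k!; one further factor k! turns each into (2k)!.
catalan-! : ∀ k → catalan k * fromℕ (suc k !) ≡ fromℕ 4 ^ k * γ k
catalan-! k = *-cancelʳ f {{fromℕ-nonZero (k !) {{k ℕ.!≢0}}}} (begin
  catalan k * fromℕ (suc k !) * f
    ≡⟨ cong (λ u → catalan k * u * f) (fromℕ-! k) ⟩
  catalan k * (fromℕ (suc k) * f) * f
    ≡⟨ solve 3 (λ c k f → c :* (k :* f) :* f := c :* k :* (f :* f)) refl (catalan k) (fromℕ (suc k)) f ⟩
  catalan k * fromℕ (suc k) * (f * f)
    ≡⟨ cong₂ _*_ (/-*-cancel ((2 ℕ.* k) C k) (suc k)) (sym (fromℕ-* (k !) (k !))) ⟩
  fromℕ ((2 ℕ.* k) C k) * fromℕ (k ! ℕ.* k !)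
    ≡⟨ trans (sym (fromℕ-* ((2 ℕ.* k) C k) (k ! ℕ.* k !))) (cong fromℕ (2nCn*n!*n! k)) ⟩
  fromℕ ((2 ℕ.* k) !)
    ≡⟨ γ-! k ⟨
  γ k * (e * f)
    ≡⟨ solve 3 (λ g e f → g :* (e :* f) := e :* g :* f) refl (γ k) e f ⟩
  e * γ k * f ∎)
  where
  e = fromℕ 4 ^ k
  f = fromℕ (k !)

-- Cleared Catalan numbers as mixed products.

mixedProduct-cong : ∀ {A A′ B B′} k r {x x′} →
  (∀ i → x + A i ≡ x′ + A′ i) → (∀ i → x + B i ≡ x′ + B′ i) →
  mixedProduct A B k r x ≡ mixedProduct A′ B′ k r x′
mixedProduct-cong k       zero    eqA eqB = Prod.sum-cong-≗ {k} λ i → eqB (toℕ i)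
mixedProduct-cong zero    (suc r) eqA eqB = refl
mixedProduct-cong (suc k) (suc r) eqA eqB =
  cong₂ _*_ (eqA 0) (mixedProduct-cong k r (eqA ∘ suc) (eqB ∘ suc))

-- Both products switch from `A` to `B` at the same index r, so they multiply factor by factor. This
-- merges the two Catalan numbers of an entry.
mixedProduct-* : ∀ {A B A₁ B₁ A₂ B₂} k r {x y z} →
  (∀ i → (x + A₁ i) * (y + A₂ i) ≡ z + A i) → (∀ i → (x + B₁ i) * (y + B₂ i) ≡ z + B i) →
  mixedProduct A₁ B₁ k r x * mixedProduct A₂ B₂ k r y ≡ mixedProduct A B k r z
mixedProduct-* {B₁ = B₁} {B₂ = B₂} k zero {x} {y} eqA eqB = trans
  (sym (Prod.∑-distrib-+ {k} (λ i → x + B₁ (toℕ i)) (λ i → y + B₂ (toℕ i))))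
  (Prod.sum-cong-≗ {k} λ i → eqB (toℕ i))
mixedProduct-* zero    (suc r) eqA eqB = refl
mixedProduct-* {A₁ = A₁} {B₁} {A₂} {B₂} (suc k) (suc r) {x} {y} eqA eqB = trans
  (solve 4 (λ a p b q → a :* p :* (b :* q) := a :* b :* (p :* q)) refl
    (x + A₁ 0) (mixedProduct (A₁ ∘ suc) (B₁ ∘ suc) k r x)
    (y + A₂ 0) (mixedProduct (A₂ ∘ suc) (B₂ ∘ suc) k r y))
  (cong₂ _*_ (eqA 0)
    (mixedProduct-* {A₁ = A₁ ∘ suc} {B₁ ∘ suc} {A₂ ∘ suc} {B₂ ∘ suc} k r (eqA ∘ suc) (eqB ∘ suc)))

-- k + i + ½ is the ratio of `γ` at k + i + 1 and k + i; k + i + 2 is the ratio of (k + i + 2)! and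
-- (k + i + 1)!.
[_+½] [_+2] : ℕ → ℚ
[ i +½] = fromℕ i + ½
[ i +2] = fromℕ i + fromℕ 2

catalanProduct : ℕ → ℕ → ℕ → ℚ
catalanProduct n r k = mixedProduct [_+½] [_+2] n r (fromℕ k)

shift-const : ∀ k i c → fromℕ k + (fromℕ (suc i) + c) ≡ fromℕ (suc k) + (fromℕ i + c)
shift-const k i c = begin
  fromℕ k + (fromℕ (suc i) + c)       ≡⟨ cong (λ u → fromℕ k + (u + c)) (fromℕ-suc i) ⟩
  fromℕ k + (1ℚ + fromℕ i + c)
    ≡⟨ solve 3 (λ k i c → k :+ (con 1ℚ :+ i :+ c) := con 1ℚ :+ k :+ (i :+ c)) refl (fromℕ k) (fromℕ i) c ⟩
  1ℚ + fromℕ k + (fromℕ i + c)        ≡⟨ cong (_+ (fromℕ i + c)) (fromℕ-suc k) ⟨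
  fromℕ (suc k) + (fromℕ i + c)       ∎

catalanProduct-shift : ∀ n r k →
  mixedProduct ([_+½] ∘ suc) ([_+2] ∘ suc) n r (fromℕ k) ≡ catalanProduct n r (suc k)
catalanProduct-shift n r k = mixedProduct-cong {[_+½] ∘ suc} {[_+½]} {[_+2] ∘ suc} {[_+2]} n r
  (λ i → shift-const k i ½) (λ i → shift-const k i (fromℕ 2))

[suc-k+n]! : ∀ n k → fromℕ ((suc k ℕ.+ n) !) ≡ fromℕ (suc k !) * catalanProduct n 0 k
[suc-k+n]! zero    k = trans (cong (λ m → fromℕ (m !)) (ℕ.+-identityʳ (suc k))) (sym (*-identityʳ _))
[suc-k+n]! (suc n) k = begin
  fromℕ ((suc k ℕ.+ suc n) !)
    ≡⟨ cong (λ m → fromℕ (m !)) (ℕ.+-suc (suc k) n) ⟩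
  fromℕ ((suc (suc k) ℕ.+ n) !)
    ≡⟨ [suc-k+n]! n (suc k) ⟩
  fromℕ (suc (suc k) !) * catalanProduct n 0 (suc k)
    ≡⟨ cong₂ _*_ (fromℕ-! (suc k)) (sym (catalanProduct-shift n 0 k)) ⟩
  fromℕ (2 ℕ.+ k) * fromℕ (suc k !) * p
    ≡⟨ cong (λ u → u * fromℕ (suc k !) * p) (fromℕ-+ 2 k) ⟩
  (fromℕ 2 + fromℕ k) * fromℕ (suc k !) * p
    ≡⟨ solve 3 (λ k f p → (con (fromℕ 2) :+ k) :* f :* p :=
         f :* ((k :+ (con 0ℚ :+ con (fromℕ 2))) :* p)) refl (fromℕ k) (fromℕ (suc k !)) p ⟩
  fromℕ (suc k !) * ((fromℕ k + [ 0 +2]) * p) ∎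
  where p = mixedProduct ([_+½] ∘ suc) ([_+2] ∘ suc) n 0 (fromℕ k)

-- Induction on r trades (k, n, r) for (k + 1, n - 1, r - 1): neither the Catalan index nor the
-- factorial changes, and `γ-suc` releases one factor with offset ½. At r = 0 the quotient (k + n +
-- 1)!/(k + 1)! provides the factors with offsets i + 2.
catalan-catalanProduct : ∀ {n r} k → r ℕ.≤ n →
  catalan (k ℕ.+ r) * fromℕ ((suc k ℕ.+ n) !) ≡ fromℕ 4 ^ (k ℕ.+ r) * (γ k * catalanProduct n r k)
catalan-catalanProduct {n} {zero} k z≤n = begin
  catalan (k ℕ.+ 0) * fromℕ ((suc k ℕ.+ n) !)
    ≡⟨ cong₂ (λ l u → catalan l * u) (ℕ.+-identityʳ k) ([suc-k+n]! n k) ⟩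
  catalan k * (fromℕ (suc k !) * p)
    ≡⟨ *-assoc (catalan k) (fromℕ (suc k !)) p ⟨
  catalan k * fromℕ (suc k !) * p
    ≡⟨ cong (_* p) (catalan-! k) ⟩
  fromℕ 4 ^ k * γ k * p
    ≡⟨ *-assoc (fromℕ 4 ^ k) (γ k) p ⟩
  fromℕ 4 ^ k * (γ k * p)
    ≡⟨ cong (λ l → fromℕ 4 ^ l * (γ k * p)) (ℕ.+-identityʳ k) ⟨
  fromℕ 4 ^ (k ℕ.+ 0) * (γ k * p) ∎
  where p = catalanProduct n 0 k
catalan-catalanProduct {suc n} {suc r} k (s≤s r≤n) = begin
  catalan (k ℕ.+ suc r) * fromℕ ((suc k ℕ.+ suc n) !)
    ≡⟨ cong₂ (λ l m → catalan l * fromℕ (m !)) (ℕ.+-suc k r) (ℕ.+-suc (suc k) n) ⟩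
  catalan (suc k ℕ.+ r) * fromℕ ((suc (suc k) ℕ.+ n) !)
    ≡⟨ catalan-catalanProduct (suc k) r≤n ⟩
  fromℕ 4 ^ (suc k ℕ.+ r) * (γ (suc k) * catalanProduct n r (suc k))
    ≡⟨ cong₂ (λ l u → fromℕ 4 ^ l * u) (sym (ℕ.+-suc k r))
         (cong₂ _*_ (γ-suc k) (sym (catalanProduct-shift n r k))) ⟩
  fromℕ 4 ^ (k ℕ.+ suc r) * ((x + ½) * γ k * p)
    ≡⟨ cong (fromℕ 4 ^ (k ℕ.+ suc r) *_)
         (solve 3 (λ x g p → (x :+ con ½) :* g :* p := g :* ((x :+ (con 0ℚ :+ con ½)) :* p)) refl x (γ k) p) ⟩
  fromℕ 4 ^ (k ℕ.+ suc r) * (γ k * ((x + [ 0 +½]) * p)) ∎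
  where
  x = fromℕ k
  p = mixedProduct ([_+½] ∘ suc) ([_+2] ∘ suc) n r x

-- Difference products expressed through `Λ`.

vandermonde-cong : ∀ {n} {X Y : Fin n → ℚ} → (∀ m → X m ≡ Y m) → vandermonde X ≡ vandermonde Y
vandermonde-cong {zero}  eq = refl
vandermonde-cong {suc n} eq = cong₂ _*_
  (Prod.sum-cong-≗ λ m → cong₂ _-_ (eq (suc m)) (eq zero)) (vandermonde-cong (eq ∘ suc))

-- Both sides are the product of t + l + m over 0 ≤ l < m ≤ n + 1; the right side isolates l = 0.
Λ-suc : ∀ n t → Λ (suc (suc n)) t ≡ pochhammer (t + fromℕ 1) (suc n) * Λ (suc n) (t + fromℕ 2)
Λ-suc n t = begin
  product {suc n} (λ i → head i * tail i)
    ≡⟨ Prod.∑-distrib-+ {suc n} head tail ⟩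
  product {suc n} head * product {suc n} tail
    ≡⟨ cong₂ _*_ (Prod.sum-cong-≗ {suc n} head≡) (trans (*-identityˡ _) (Prod.sum-cong-≗ {n} tail≡)) ⟩
  pochhammer (t + fromℕ 1) (suc n) * Λ (suc n) (t + fromℕ 2) ∎
  where
  head tail : Fin (suc n) → ℚ
  head i = t + fromℕ (suc (toℕ i)) + 0ℚ
  tail i = product {toℕ i} (λ l → t + fromℕ (suc (toℕ i)) + fromℕ (suc (toℕ l)))
  head≡ : ∀ i → head i ≡ t + fromℕ 1 + fromℕ (toℕ i)
  head≡ i = trans (cong (λ u → t + u + 0ℚ) (fromℕ-suc (toℕ i)))
    (solve 2 (λ t i → t :+ (con 1ℚ :+ i) :+ con 0ℚ := t :+ con 1ℚ :+ i) refl t (fromℕ (toℕ i)))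
  tail≡ : ∀ i → tail (suc i) ≡ pochhammer (t + fromℕ 2 + fromℕ (suc (toℕ i))) (suc (toℕ i))
  tail≡ i = Prod.sum-cong-≗ {suc (toℕ i)} λ l → begin
    t + fromℕ (suc (suc (toℕ i))) + fromℕ (suc (toℕ l))
      ≡⟨ cong₂ (λ u v → t + u + v) (fromℕ-suc (suc (toℕ i))) (fromℕ-suc (toℕ l)) ⟩
    t + (1ℚ + fromℕ (suc (toℕ i))) + (1ℚ + fromℕ (toℕ l))
      ≡⟨ solve 3 (λ t i l → t :+ (con 1ℚ :+ i) :+ (con 1ℚ :+ l) := t :+ con (fromℕ 2) :+ i :+ l) refl
           t (fromℕ (suc (toℕ i))) (fromℕ (toℕ l)) ⟩
    t + fromℕ 2 + fromℕ (suc (toℕ i)) + fromℕ (toℕ l) ∎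

-- The scalar left over when a product over l < m is peeled off by Λ-suc.
factorTower : (ℕ → ℚ) → ℕ → ℚ
factorTower f zero    = 1ℚ
factorTower f (suc n) = (∏[ 0 ≤ i < suc n ] f i) * factorTower f n

-- Dropping node 0 replaces (x, y) by (x - 1, y + 1), so `y - x` grows by 2, which is the shift in
-- `Λ-suc`.
vandermonde-quadratic : ∀ n x y →
  vandermonde {suc n} (λ m → (x - fromℕ (toℕ m)) * (y + fromℕ (toℕ m)))
    ≡ factorTower (λ i → - fromℕ (suc i)) n * Λ (suc n) (y - x)
vandermonde-quadratic zero    x y = refl
vandermonde-quadratic (suc n) x y = begin
  product (λ m → X (suc m) - X zero) * vandermonde (X ∘ suc)
    ≡⟨ cong₂ _*_
         (trans (Prod.sum-cong-≗ {suc n} difference)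
           (Prod.∑-distrib-+ {suc n} (λ m → - fromℕ (suc (toℕ m))) (λ m → y - x + fromℕ 1 + fromℕ (toℕ m))))
         (trans (vandermonde-cong shift) (vandermonde-quadratic n (x - 1ℚ) (y + 1ℚ))) ⟩
  c * p * (f * Λ (suc n) (y + 1ℚ - (x - 1ℚ)))
    ≡⟨ cong (λ u → c * p * (f * Λ (suc n) u))
         (solve 2 (λ x y → y :+ con 1ℚ :- (x :- con 1ℚ) := y :- x :+ con (fromℕ 2)) refl x y) ⟩
  c * p * (f * Λ (suc n) (y - x + fromℕ 2))
    ≡⟨ solve 4 (λ c p f l → c :* p :* (f :* l) := c :* f :* (p :* l)) refl c p f (Λ (suc n) (y - x + fromℕ 2)) ⟩
  c * f * (p * Λ (suc n) (y - x + fromℕ 2))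
    ≡⟨ cong (c * f *_) (Λ-suc n (y - x)) ⟨
  c * f * Λ (suc (suc n)) (y - x) ∎
  where
  X : Fin (suc (suc n)) → ℚ
  X m = (x - fromℕ (toℕ m)) * (y + fromℕ (toℕ m))
  c = ∏[ 0 ≤ i < suc n ] (- fromℕ (suc i))
  p = pochhammer (y - x + fromℕ 1) (suc n)
  f = factorTower (λ i → - fromℕ (suc i)) n
  difference : ∀ m → X (suc m) - X zero ≡ - fromℕ (suc (toℕ m)) * (y - x + fromℕ 1 + fromℕ (toℕ m))
  difference m rewrite fromℕ-suc (toℕ m) =
    solve 3 (λ x y m → (x :- (con 1ℚ :+ m)) :* (y :+ (con 1ℚ :+ m)) :- (x :- con 0ℚ) :* (y :+ con 0ℚ) :=
      :- (con 1ℚ :+ m) :* (y :- x :+ con 1ℚ :+ m)) refl x y (fromℕ (toℕ m))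
  shift : ∀ m → X (suc m) ≡ (x - 1ℚ - fromℕ (toℕ m)) * (y + 1ℚ + fromℕ (toℕ m))
  shift m rewrite fromℕ-suc (toℕ m) =
    solve 3 (λ x y m → (x :- (con 1ℚ :+ m)) :* (y :+ (con 1ℚ :+ m)) :=
      (x :- con 1ℚ :- m) :* (y :+ con 1ℚ :+ m)) refl x y (fromℕ (toℕ m))

-- With j as the difference of the two indices, shifting both sequences leaves j + 3/2 alone and
-- raises `u` by 2, again the shift in `Λ-suc`.
mixedFactor-quadratic : ∀ n A B u →
  (∀ i j → - A i + B (i ℕ.+ j) ≡ (fromℕ j + + 3 / 2) * (u + fromℕ 2 * fromℕ i + fromℕ 1 + fromℕ j)) →
  mixedFactor A B n ≡ factorTower (λ j → fromℕ j + + 3 / 2) n * Λ (suc n) u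
mixedFactor-quadratic zero    A B u eq = refl
mixedFactor-quadratic (suc n) A B u eq = begin
  linearProduct B (suc n) (- A 0) * mixedFactor (A ∘ suc) (B ∘ suc) n
    ≡⟨ cong₂ _*_
         (trans (Prod.sum-cong-≗ {suc n} difference)
           (Prod.∑-distrib-+ {suc n} (λ j → fromℕ (toℕ j) + + 3 / 2) (λ j → u + fromℕ 1 + fromℕ (toℕ j))))
         (mixedFactor-quadratic n (A ∘ suc) (B ∘ suc) (u + fromℕ 2) shift) ⟩
  c * p * (f * Λ (suc n) (u + fromℕ 2))
    ≡⟨ solve 4 (λ c p f l → c :* p :* (f :* l) := c :* f :* (p :* l)) refl c p f (Λ (suc n) (u + fromℕ 2)) ⟩
  c * f * (p * Λ (suc n) (u + fromℕ 2))
    ≡⟨ cong (c * f *_) (Λ-suc n u) ⟨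
  c * f * Λ (suc (suc n)) u ∎
  where
  c = ∏[ 0 ≤ j < suc n ] (fromℕ j + + 3 / 2)
  p = pochhammer (u + fromℕ 1) (suc n)
  f = factorTower (λ j → fromℕ j + + 3 / 2) n
  difference : ∀ j → - A 0 + B (toℕ j) ≡ (fromℕ (toℕ j) + + 3 / 2) * (u + fromℕ 1 + fromℕ (toℕ j))
  difference j = trans (eq 0 (toℕ j)) (cong (λ v → (fromℕ (toℕ j) + + 3 / 2) * (v + fromℕ 1 + fromℕ (toℕ j)))
    (solve 1 (λ u → u :+ con (fromℕ 2) :* con 0ℚ := u) refl u))
  shift : ∀ i j → - A (suc i) + B (suc i ℕ.+ j) ≡
    (fromℕ j + + 3 / 2) * (u + fromℕ 2 + fromℕ 2 * fromℕ i + fromℕ 1 + fromℕ j)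
  shift i j = trans (eq (suc i) j) (cong (λ v → (fromℕ j + + 3 / 2) * (v + fromℕ 1 + fromℕ j))
    (trans (cong (λ v → u + fromℕ 2 * v) (fromℕ-suc i))
      (solve 2 (λ u i → u :+ con (fromℕ 2) :* (con 1ℚ :+ i) := u :+ con (fromℕ 2) :+ con (fromℕ 2) :* i)
        refl u (fromℕ i))))

-- Collecting the constants.

∏-snoc : ∀ n (f : ℕ → ℚ) → (∏[ 0 ≤ k < suc n ] f k) ≡ (∏[ 0 ≤ k < n ] f k) * f n
∏-snoc n f = trans (Prod.sum-init-last {n} (λ i → f (toℕ i)))
  (cong₂ _*_ (Prod.sum-cong-≗ {n} λ i → cong f (toℕ-inject₁ i)) (cong f (toℕ-fromℕ n)))

-- From n to n + 1 the left side gains 16 · (-(n+1)) · (n + 3/2) = -4 (2n+2)(2n+3), as does the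
-- right side.
∏-odd-factorial : ∀ n →
  fromℕ 4 ^ (2 ℕ.* n) * (∏[ 0 ≤ i < n ] (- fromℕ (suc i))) * (∏[ 0 ≤ j < n ] (fromℕ j + + 3 / 2))
    ≡ (- fromℕ 4) ^ n * fromℕ ((2 ℕ.* n ℕ.+ 1) !)
∏-odd-factorial zero    = refl
∏-odd-factorial (suc n) = begin
  fromℕ 4 ^ (2 ℕ.* suc n) * (∏[ 0 ≤ i < suc n ] (- fromℕ (suc i))) * (∏[ 0 ≤ j < suc n ] (fromℕ j + + 3 / 2))
    ≡⟨ cong₂ _*_ (cong₂ _*_ (cong (fromℕ 4 ^_) (ℕ.*-suc 2 n))
         (trans (∏-snoc n (λ i → - fromℕ (suc i))) (cong (λ u → p * - u) (fromℕ-suc n))))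
         (∏-snoc n (λ j → fromℕ j + + 3 / 2)) ⟩
  fromℕ 4 * (fromℕ 4 * e) * (p * - (1ℚ + x)) * (q * (x + + 3 / 2))
    ≡⟨ solve 4 (λ x e p q →
         con (fromℕ 4) :* (con (fromℕ 4) :* e) :* (p :* :- (con 1ℚ :+ x)) :* (q :* (x :+ con (+ 3 / 2))) :=
         :- con (fromℕ 4) :* (con (fromℕ 2) :* x :+ con (fromℕ 3))
           :* (con (fromℕ 2) :* x :+ con (fromℕ 2)) :* (e :* p :* q))
         refl x e p q ⟩
  - fromℕ 4 * (fromℕ 2 * x + fromℕ 3) * (fromℕ 2 * x + fromℕ 2) * (e * p * q)
    ≡⟨ cong (- fromℕ 4 * (fromℕ 2 * x + fromℕ 3) * (fromℕ 2 * x + fromℕ 2) *_) (∏-odd-factorial n) ⟩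
  - fromℕ 4 * (fromℕ 2 * x + fromℕ 3) * (fromℕ 2 * x + fromℕ 2) * (s * f)
    ≡⟨ solve 4 (λ a b s f → :- con (fromℕ 4) :* a :* b :* (s :* f) := :- con (fromℕ 4) :* s :* (a :* (b :* f)))
         refl (fromℕ 2 * x + fromℕ 3) (fromℕ 2 * x + fromℕ 2) s f ⟩
  - fromℕ 4 * s * ((fromℕ 2 * x + fromℕ 3) * ((fromℕ 2 * x + fromℕ 2) * f))
    ≡⟨ cong (- fromℕ 4 * s *_) factorial ⟨
  (- fromℕ 4) ^ suc n * fromℕ ((2 ℕ.* suc n ℕ.+ 1) !) ∎
  where
  x = fromℕ n
  e = fromℕ 4 ^ (2 ℕ.* n)
  p = ∏[ 0 ≤ i < n ] (- fromℕ (suc i))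
  q = ∏[ 0 ≤ j < n ] (fromℕ j + + 3 / 2)
  s = (- fromℕ 4) ^ n
  f = fromℕ ((2 ℕ.* n ℕ.+ 1) !)
  k = 2 ℕ.* n ℕ.+ 1
  linear : ∀ c → fromℕ (2 ℕ.* n ℕ.+ c) ≡ fromℕ 2 * x + fromℕ c
  linear c = trans (fromℕ-+ (2 ℕ.* n) c) (cong (_+ fromℕ c) (fromℕ-* 2 n))
  factorial : fromℕ ((2 ℕ.* suc n ℕ.+ 1) !) ≡ (fromℕ 2 * x + fromℕ 3) * ((fromℕ 2 * x + fromℕ 2) * f)
  factorial = begin
    fromℕ ((2 ℕ.* suc n ℕ.+ 1) !)
      ≡⟨ cong (λ l → fromℕ ((l ℕ.+ 1) !)) (ℕ.*-suc 2 n) ⟩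
    fromℕ (suc (suc k) !)
      ≡⟨ trans (fromℕ-! (suc k)) (cong (fromℕ (2 ℕ.+ k) *_) (fromℕ-! k)) ⟩
    fromℕ (2 ℕ.+ k) * (fromℕ (1 ℕ.+ k) * f)
      ≡⟨ cong₂ (λ l m → fromℕ l * (fromℕ m * f))
           (trans (ℕ.+-comm 2 k) (ℕ.+-assoc (2 ℕ.* n) 1 2)) (trans (ℕ.+-comm 1 k) (ℕ.+-assoc (2 ℕ.* n) 1 1)) ⟩
    fromℕ (2 ℕ.* n ℕ.+ 3) * (fromℕ (2 ℕ.* n ℕ.+ 2) * f)
      ≡⟨ cong₂ (λ u v → u * (v * f)) (linear 3) (linear 2) ⟩
    (fromℕ 2 * x + fromℕ 3) * ((fromℕ 2 * x + fromℕ 2) * f) ∎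

-- Each level of the two towers pairs with the power of 4 of one row. The exponents of -4 add up to
-- 1 + ... + n, a binomial coefficient by Pascal's rule.
factorTower-constant : ∀ n →
  (∏[ 0 ≤ r < suc n ] (fromℕ 4 ^ (2 ℕ.* r))) * factorTower (λ i → - fromℕ (suc i)) n
    * factorTower (λ j → fromℕ j + + 3 / 2) n
    ≡ (- fromℕ 4) ^ (suc n C 2) * (∏[ 1 ≤ k < suc n ] fromℕ ((2 ℕ.* k ℕ.+ 1) !))
factorTower-constant zero    = refl
factorTower-constant (suc n) = begin
  (∏[ 0 ≤ r < suc (suc n) ] (fromℕ 4 ^ (2 ℕ.* r))) * (p * c) * (q * d)
    ≡⟨ cong (λ v → v * (p * c) * (q * d)) (∏-snoc (suc n) (λ r → fromℕ 4 ^ (2 ℕ.* r))) ⟩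
  u * e * (p * c) * (q * d)
    ≡⟨ solve 6 (λ u e p c q d → u :* e :* (p :* c) :* (q :* d) := (e :* p :* q) :* (u :* c :* d)) refl u e p c q d ⟩
  (e * p * q) * (u * c * d)
    ≡⟨ cong₂ _*_ (∏-odd-factorial (suc n)) (factorTower-constant n) ⟩
  s * f * (z * g)
    ≡⟨ solve 4 (λ s f z g → s :* f :* (z :* g) := s :* z :* (g :* f)) refl s f z g ⟩
  s * z * (g * f)
    ≡⟨ cong₂ _*_ (sym (^-homo-* (- fromℕ 4) (suc n) (suc n C 2)))
         (sym (∏-snoc n (λ k → fromℕ ((2 ℕ.* suc k ℕ.+ 1) !)))) ⟩
  (- fromℕ 4) ^ (suc n ℕ.+ (suc n C 2)) * (∏[ 1 ≤ k < suc (suc n) ] fromℕ ((2 ℕ.* k ℕ.+ 1) !))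
    ≡⟨ cong (λ k → (- fromℕ 4) ^ k * (∏[ 1 ≤ k < suc (suc n) ] fromℕ ((2 ℕ.* k ℕ.+ 1) !)))
         (trans (cong (ℕ._+ (suc n C 2)) (sym (nC1≡n (suc n)))) (nCk+nC[k+1]≡[n+1]C[k+1] (suc n) 1)) ⟩
  (- fromℕ 4) ^ (suc (suc n) C 2) * (∏[ 1 ≤ k < suc (suc n) ] fromℕ ((2 ℕ.* k ℕ.+ 1) !)) ∎
  where
  u = ∏[ 0 ≤ r < suc n ] (fromℕ 4 ^ (2 ℕ.* r))
  e = fromℕ 4 ^ (2 ℕ.* suc n)
  p = ∏[ 0 ≤ i < suc n ] (- fromℕ (suc i))
  q = ∏[ 0 ≤ j < suc n ] (fromℕ j + + 3 / 2)
  c = factorTower (λ i → - fromℕ (suc i)) n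
  d = factorTower (λ j → fromℕ j + + 3 / 2) n
  s = (- fromℕ 4) ^ suc n
  f = fromℕ ((2 ℕ.* suc n ℕ.+ 1) !)
  z = (- fromℕ 4) ^ (suc n C 2)
  g = ∏[ 1 ≤ k < suc n ] fromℕ ((2 ℕ.* k ℕ.+ 1) !)

-- Matrix entries and column denominators.

catalan-entry : ∀ {a b n r m} → r ℕ.≤ n → m ℕ.≤ a →
  (fromℕ ((suc (a ℕ.∸ m) ℕ.+ n) !) * fromℕ ((suc (b ℕ.+ m) ℕ.+ n) !))
    * (catalan (a ℕ.+ r ℕ.∸ m) * catalan (b ℕ.+ r ℕ.+ m))
  ≡ (fromℕ 4 ^ (a ℕ.+ b) * (γ (a ℕ.∸ m) * γ (b ℕ.+ m)))
    * (fromℕ 4 ^ (2 ℕ.* r) * (catalanProduct n r (a ℕ.∸ m) * catalanProduct n r (b ℕ.+ m)))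
catalan-entry {a} {b} {n} {r} {m} r≤n m≤a = begin
  (fp * fq) * (catalan (a ℕ.+ r ℕ.∸ m) * catalan (b ℕ.+ r ℕ.+ m))
    ≡⟨ cong₂ (λ k l → (fp * fq) * (catalan k * catalan l)) (ℕ.+-∸-comm r m≤a)
         (trans (ℕ.+-assoc b r m) (trans (cong (b ℕ.+_) (ℕ.+-comm r m)) (sym (ℕ.+-assoc b m r)))) ⟩
  (fp * fq) * (catalan (p ℕ.+ r) * catalan (q ℕ.+ r))
    ≡⟨ solve 4 (λ f g c d → (f :* g) :* (c :* d) := (c :* f) :* (d :* g)) refl
         fp fq (catalan (p ℕ.+ r)) (catalan (q ℕ.+ r)) ⟩
  (catalan (p ℕ.+ r) * fp) * (catalan (q ℕ.+ r) * fq)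
    ≡⟨ cong₂ _*_ (catalan-catalanProduct p r≤n) (catalan-catalanProduct q r≤n) ⟩
  (fromℕ 4 ^ (p ℕ.+ r) * (γ p * P)) * (fromℕ 4 ^ (q ℕ.+ r) * (γ q * Q))
    ≡⟨ solve 6 (λ e f g h p q → (e :* (g :* p)) :* (f :* (h :* q)) := (e :* f) :* ((g :* h) :* (p :* q))) refl
         (fromℕ 4 ^ (p ℕ.+ r)) (fromℕ 4 ^ (q ℕ.+ r)) (γ p) (γ q) P Q ⟩
  (fromℕ 4 ^ (p ℕ.+ r) * fromℕ 4 ^ (q ℕ.+ r)) * ((γ p * γ q) * (P * Q))
    ≡⟨ cong (_* ((γ p * γ q) * (P * Q))) powers ⟩
  (fromℕ 4 ^ (a ℕ.+ b) * fromℕ 4 ^ (2 ℕ.* r)) * ((γ p * γ q) * (P * Q))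
    ≡⟨ solve 4 (λ e f g p → (e :* f) :* (g :* p) := (e :* g) :* (f :* p)) refl
         (fromℕ 4 ^ (a ℕ.+ b)) (fromℕ 4 ^ (2 ℕ.* r)) (γ p * γ q) (P * Q) ⟩
  (fromℕ 4 ^ (a ℕ.+ b) * (γ p * γ q)) * (fromℕ 4 ^ (2 ℕ.* r) * (P * Q)) ∎
  where
  p = a ℕ.∸ m
  q = b ℕ.+ m
  fp = fromℕ ((suc p ℕ.+ n) !)
  fq = fromℕ ((suc q ℕ.+ n) !)
  P = catalanProduct n r p
  Q = catalanProduct n r q
  -- With a written as p + m the exponent identity is free of truncated subtraction, hence within
  -- reach of the ring solver.
  rearrange : ∀ p b m r → (p ℕ.+ r) ℕ.+ ((b ℕ.+ m) ℕ.+ r) ≡ ((p ℕ.+ m) ℕ.+ b) ℕ.+ 2 ℕ.* r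
  rearrange = solve-∀
  exponents : (p ℕ.+ r) ℕ.+ (q ℕ.+ r) ≡ (a ℕ.+ b) ℕ.+ 2 ℕ.* r
  exponents = trans (rearrange p b m r)
    (cong (λ k → (k ℕ.+ b) ℕ.+ 2 ℕ.* r) (ℕ.m∸n+n≡m m≤a))
  powers : fromℕ 4 ^ (p ℕ.+ r) * fromℕ 4 ^ (q ℕ.+ r) ≡ fromℕ 4 ^ (a ℕ.+ b) * fromℕ 4 ^ (2 ℕ.* r)
  powers = begin
    fromℕ 4 ^ (p ℕ.+ r) * fromℕ 4 ^ (q ℕ.+ r)        ≡⟨ ^-homo-* (fromℕ 4) (p ℕ.+ r) (q ℕ.+ r) ⟨
    fromℕ 4 ^ ((p ℕ.+ r) ℕ.+ (q ℕ.+ r))              ≡⟨ cong (fromℕ 4 ^_) exponents ⟩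
    fromℕ 4 ^ ((a ℕ.+ b) ℕ.+ 2 ℕ.* r)                ≡⟨ ^-homo-* (fromℕ 4) (a ℕ.+ b) (2 ℕ.* r) ⟩
    fromℕ 4 ^ (a ℕ.+ b) * fromℕ 4 ^ (2 ℕ.* r)        ∎

-- (x + c)(y + c) = x y + (c s + c²) depends on m only through x y, since s = x + y is constant.
offsets : (ℕ → ℚ) → ℚ → ℕ → ℚ
offsets c s i = c i * s + c i * c i

catalanProduct-* : ∀ {a b m} n r → m ℕ.≤ a →
  catalanProduct n r (a ℕ.∸ m) * catalanProduct n r (b ℕ.+ m)
  ≡ mixedProduct (offsets [_+½] (fromℕ a + fromℕ b)) (offsets [_+2] (fromℕ a + fromℕ b)) n r
      ((fromℕ a - fromℕ m) * (fromℕ b + fromℕ m))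
catalanProduct-* {a} {b} {m} n r m≤a = mixedProduct-* n r
  (λ i → factor [ i +½]) (λ i → factor [ i +2])
  where
  s = fromℕ a + fromℕ b
  factor : ∀ c → (fromℕ (a ℕ.∸ m) + c) * (fromℕ (b ℕ.+ m) + c) ≡
    (fromℕ a - fromℕ m) * (fromℕ b + fromℕ m) + (c * s + c * c)
  factor c = trans (cong₂ (λ u v → (u + c) * (v + c)) (fromℕ-∸ m≤a) (fromℕ-+ b m))
    (solve 4 (λ a b m c → (a :- m :+ c) :* (b :+ m :+ c) :=
      (a :- m) :* (b :+ m) :+ (c :* (a :+ b) :+ c :* c)) refl (fromℕ a) (fromℕ b) (fromℕ m) c)

-- With c = i + j + 2 and d = i + ½, the difference of c s + c² and d s + d² factors as (c - d)(s +
-- c + d).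
offsets-difference : ∀ s i j → - offsets [_+½] s i + offsets [_+2] s (i ℕ.+ j)
  ≡ (fromℕ j + + 3 / 2) * (s + + 3 / 2 + fromℕ 2 * fromℕ i + fromℕ 1 + fromℕ j)
offsets-difference s i j rewrite fromℕ-+ i j =
  solve 3 (λ s i j →
    :- ((i :+ con ½) :* s :+ (i :+ con ½) :* (i :+ con ½))
      :+ ((i :+ j :+ con (fromℕ 2)) :* s :+ (i :+ j :+ con (fromℕ 2)) :* (i :+ j :+ con (fromℕ 2)))
    := (j :+ con (+ 3 / 2)) :* (s :+ con (+ 3 / 2) :+ con (fromℕ 2) :* i :+ con (fromℕ 1) :+ j))
    refl s (fromℕ i) (fromℕ j)

∏-range : ∀ {n} lo hi (f : ℕ → ℚ) → hi ℕ.∸ lo ≡ n → (∏[ lo ≤ k < hi ] f k) ≡ ∏[ 0 ≤ i < n ] f (lo ℕ.+ i)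
∏-range lo hi f refl = refl

∏-reverse : ∀ n (f : ℕ → ℚ) → (∏[ 0 ≤ i < n ] f i) ≡ ∏[ 0 ≤ i < n ] f (n ℕ.∸ suc i)
∏-reverse n f = trans (Prod.sum-permute {n} {n} (λ i → f (toℕ i)) reverse)
  (Prod.sum-cong-≗ {n} λ i → cong f (opposite-prop i))

-- Column m has the factorials (a + k - 1)! for k = n - m + 2 and (b + k - 1)! for k = n + 2 + m.
-- The first index runs through 2, ..., N + 1 backwards, the second through N + 1, ..., 2N.
denominator : ∀ {n a} b → n ℕ.≤ a →
  product {suc n} (λ m → fromℕ ((suc (a ℕ.∸ toℕ m) ℕ.+ n) !) * fromℕ ((suc (b ℕ.+ toℕ m) ℕ.+ n) !))
  ≡ (∏[ 2 ≤ k < suc n ℕ.+ 2 ] fromℕ ((a ℕ.+ k ℕ.∸ 1) !))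
    * (∏[ suc n ℕ.+ 1 ≤ k < 2 ℕ.* suc n ℕ.+ 1 ] fromℕ ((b ℕ.+ k ℕ.∸ 1) !))
denominator {n} {a} b n≤a = trans
  (Prod.∑-distrib-+ {suc n} (λ m → fromℕ ((suc (a ℕ.∸ toℕ m) ℕ.+ n) !))
    (λ m → fromℕ ((suc (b ℕ.+ toℕ m) ℕ.+ n) !)))
  (cong₂ _*_ left right)
  where
  left : (∏[ 0 ≤ m < suc n ] fromℕ ((suc (a ℕ.∸ m) ℕ.+ n) !))
    ≡ ∏[ 2 ≤ k < suc n ℕ.+ 2 ] fromℕ ((a ℕ.+ k ℕ.∸ 1) !)
  left = begin
    (∏[ 0 ≤ m < suc n ] fromℕ ((suc (a ℕ.∸ m) ℕ.+ n) !))
      ≡⟨ Prod.sum-cong-≗ {suc n} (λ m → cong (λ k → fromℕ (k !)) (index (toℕ m) (ℕ.≤-pred (toℕ<n m)))) ⟩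
    (∏[ 0 ≤ m < suc n ] fromℕ ((a ℕ.+ (2 ℕ.+ (n ℕ.∸ m)) ℕ.∸ 1) !))
      ≡⟨ ∏-reverse (suc n) (λ i → fromℕ ((a ℕ.+ (2 ℕ.+ i) ℕ.∸ 1) !)) ⟨
    (∏[ 0 ≤ i < suc n ] fromℕ ((a ℕ.+ (2 ℕ.+ i) ℕ.∸ 1) !))
      ≡⟨ ∏-range 2 (suc n ℕ.+ 2) (λ k → fromℕ ((a ℕ.+ k ℕ.∸ 1) !)) (ℕ.m+n∸n≡m (suc n) 2) ⟨
    (∏[ 2 ≤ k < suc n ℕ.+ 2 ] fromℕ ((a ℕ.+ k ℕ.∸ 1) !)) ∎
    where
    index : ∀ m → m ℕ.≤ n → suc (a ℕ.∸ m) ℕ.+ n ≡ a ℕ.+ (2 ℕ.+ (n ℕ.∸ m)) ℕ.∸ 1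
    index m m≤n = begin
      suc (a ℕ.∸ m ℕ.+ n)                ≡⟨ cong suc (ℕ.+-∸-comm n (ℕ.≤-trans m≤n n≤a)) ⟨
      suc (a ℕ.+ n ℕ.∸ m)                ≡⟨ cong suc (ℕ.+-∸-assoc a m≤n) ⟩
      suc (a ℕ.+ (n ℕ.∸ m))              ≡⟨ ℕ.+-suc a (n ℕ.∸ m) ⟨
      a ℕ.+ suc (n ℕ.∸ m)                ≡⟨ cong (ℕ._∸ 1) (ℕ.+-suc a (suc (n ℕ.∸ m))) ⟨
      a ℕ.+ (2 ℕ.+ (n ℕ.∸ m)) ℕ.∸ 1      ∎
  right : (∏[ 0 ≤ m < suc n ] fromℕ ((suc (b ℕ.+ m) ℕ.+ n) !))
    ≡ ∏[ suc n ℕ.+ 1 ≤ k < 2 ℕ.* suc n ℕ.+ 1 ] fromℕ ((b ℕ.+ k ℕ.∸ 1) !)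
  right = begin
    (∏[ 0 ≤ m < suc n ] fromℕ ((suc (b ℕ.+ m) ℕ.+ n) !))
      ≡⟨ Prod.sum-cong-≗ {suc n} (λ m → cong (λ k → fromℕ (k !)) (index (toℕ m))) ⟩
    (∏[ 0 ≤ m < suc n ] fromℕ ((b ℕ.+ (suc n ℕ.+ 1 ℕ.+ m) ℕ.∸ 1) !))
      ≡⟨ ∏-range (suc n ℕ.+ 1) (2 ℕ.* suc n ℕ.+ 1) (λ k → fromℕ ((b ℕ.+ k ℕ.∸ 1) !)) length ⟨
    (∏[ suc n ℕ.+ 1 ≤ k < 2 ℕ.* suc n ℕ.+ 1 ] fromℕ ((b ℕ.+ k ℕ.∸ 1) !)) ∎
    where
    index : ∀ m → suc (b ℕ.+ m) ℕ.+ n ≡ b ℕ.+ (suc n ℕ.+ 1 ℕ.+ m) ℕ.∸ 1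
    index m = cong (ℕ._∸ 1) (rearrange b m n)
      where
      rearrange : ∀ b m n → 2 ℕ.+ (b ℕ.+ m) ℕ.+ n ≡ b ℕ.+ (1 ℕ.+ n ℕ.+ 1 ℕ.+ m)
      rearrange = solve-∀
    double : ∀ n → 2 ℕ.* n ℕ.+ 1 ≡ n ℕ.+ (n ℕ.+ 1)
    double = solve-∀
    length : 2 ℕ.* suc n ℕ.+ 1 ℕ.∸ (suc n ℕ.+ 1) ≡ suc n
    length = trans (cong (ℕ._∸ (suc n ℕ.+ 1)) (double (suc n)))
      (ℕ.m+n∸n≡m (suc n) (suc n ℕ.+ 1))

theorem18p8 : (N a b : ℕ) → N ℕ.≤ a ℕ.+ 1 → a ℕ.+ 1 ℕ.≤ b →
    det {N} (λ r m → catalan (a ℕ.+ toℕ r ℕ.∸ toℕ m) * catalan (b ℕ.+ toℕ r ℕ.+ toℕ m))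
    ≡ (- fromℕ 4) ^ (N C 2)
    * fromℕ 4 ^ (N ℕ.* (a ℕ.+ b))
    * (∏[ 1 ≤ k < N ] fromℕ ((2 ℕ.* k ℕ.+ 1) !))
    * ((∏[ 0 ≤ k < N ] (γ (a ℕ.∸ k) * γ (b ℕ.+ k)))
    ÷ ((∏[ 2 ≤ k < N ℕ.+ 2 ] fromℕ ((a ℕ.+ k ℕ.∸ 1) !))
    * (∏[ N ℕ.+ 1 ≤ k < 2 ℕ.* N ℕ.+ 1 ] fromℕ ((b ℕ.+ k ℕ.∸ 1) !))))
    {{∏!*∏!-nonZero 2 (N ℕ.+ 2) (λ k → a ℕ.+ k ℕ.∸ 1)
    (N ℕ.+ 1) (2 ℕ.* N ℕ.+ 1) (λ k → b ℕ.+ k ℕ.∸ 1)}}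
    * Λ N (fromℕ b - fromℕ a)
    * Λ N (fromℕ a + fromℕ b + (+ 3 / 2))
theorem18p8 zero    a b _ _ = refl
theorem18p8 (suc n) a b N≤a+1 _ = begin
  det E
    ≡⟨ *≡⇒≡÷ D det*D ⟩
  4ᴺ * Γ * (U * (d * Λ₂ * (c * Λ₁))) * 1/ D
    ≡⟨ solve 8 (λ e g u d l₂ c l₁ i → e :* g :* (u :* (d :* l₂ :* (c :* l₁))) :* i :=
         (u :* c :* d) :* e :* (g :* i) :* l₁ :* l₂) refl 4ᴺ Γ U d Λ₂ c Λ₁ (1/ D) ⟩
  (U * c * d) * 4ᴺ * (Γ * 1/ D) * Λ₁ * Λ₂
    ≡⟨ cong (λ k → k * (Γ * 1/ D) * Λ₁ * Λ₂) constants ⟩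
  s * fromℕ 4 ^ (suc n ℕ.* (a ℕ.+ b)) * o * (Γ ÷ D) * Λ₁ * Λ₂ ∎
  where
  -- Every column index is thus at most a, which makes `a ℕ.∸ toℕ m` a genuine difference.
  n≤a : n ℕ.≤ a
  n≤a = ℕ.≤-pred (subst (suc n ℕ.≤_) (ℕ.+-comm a 1) N≤a+1)
  E M : Fin (suc n) → Fin (suc n) → ℚ
  E r m = catalan (a ℕ.+ toℕ r ℕ.∸ toℕ m) * catalan (b ℕ.+ toℕ r ℕ.+ toℕ m)
  A = offsets [_+½] (fromℕ a + fromℕ b)
  B = offsets [_+2] (fromℕ a + fromℕ b)
  X F G : Fin (suc n) → ℚ
  X m = (fromℕ a - fromℕ (toℕ m)) * (fromℕ b + fromℕ (toℕ m))
  M r m = mixedProduct A B n (toℕ r) (X m)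
  F m = fromℕ ((suc (a ℕ.∸ toℕ m) ℕ.+ n) !) * fromℕ ((suc (b ℕ.+ toℕ m) ℕ.+ n) !)
  G m = fromℕ 4 ^ (a ℕ.+ b) * (γ (a ℕ.∸ toℕ m) * γ (b ℕ.+ toℕ m))
  D = (∏[ 2 ≤ k < suc n ℕ.+ 2 ] fromℕ ((a ℕ.+ k ℕ.∸ 1) !))
    * (∏[ suc n ℕ.+ 1 ≤ k < 2 ℕ.* suc n ℕ.+ 1 ] fromℕ ((b ℕ.+ k ℕ.∸ 1) !))
  instance
    D≢0 : NonZero D
    D≢0 = ∏!*∏!-nonZero 2 (suc n ℕ.+ 2) (λ k → a ℕ.+ k ℕ.∸ 1)
      (suc n ℕ.+ 1) (2 ℕ.* suc n ℕ.+ 1) (λ k → b ℕ.+ k ℕ.∸ 1)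
  4ᴺ = (fromℕ 4 ^ (a ℕ.+ b)) ^ suc n
  Γ = ∏[ 0 ≤ k < suc n ] (γ (a ℕ.∸ k) * γ (b ℕ.+ k))
  U = ∏[ 0 ≤ r < suc n ] (fromℕ 4 ^ (2 ℕ.* r))
  c = factorTower (λ i → - fromℕ (suc i)) n
  d = factorTower (λ j → fromℕ j + + 3 / 2) n
  Λ₁ = Λ (suc n) (fromℕ b - fromℕ a)
  Λ₂ = Λ (suc n) (fromℕ a + fromℕ b + + 3 / 2)
  s = (- fromℕ 4) ^ (suc n C 2)
  o = ∏[ 1 ≤ k < suc n ] fromℕ ((2 ℕ.* k ℕ.+ 1) !)

  entry : ∀ r m → F m * E r m ≡ G m * (fromℕ 4 ^ (2 ℕ.* toℕ r) * M r m)
  entry r m = trans (catalan-entry {a} {b} {n} {toℕ r} {toℕ m} (ℕ.≤-pred (toℕ<n r)) m≤a)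
    (cong (λ u → G m * (fromℕ 4 ^ (2 ℕ.* toℕ r) * u)) (catalanProduct-* {a} {b} n (toℕ r) m≤a))
    where m≤a = ℕ.≤-trans (ℕ.≤-pred (toℕ<n m)) n≤a

  det*D : det E * D ≡ 4ᴺ * Γ * (U * (d * Λ₂ * (c * Λ₁)))
  det*D = begin
    det E * D
      ≡⟨ trans (*-comm (det E) D) (cong (_* det E) (sym (denominator b n≤a))) ⟩
    product F * det E
      ≡⟨ det-scaleCols F E ⟨
    det (λ r m → F m * E r m)
      ≡⟨ det-cong entry ⟩
    det (λ r m → G m * (fromℕ 4 ^ (2 ℕ.* toℕ r) * M r m))
      ≡⟨ trans (det-scaleCols G (λ r m → fromℕ 4 ^ (2 ℕ.* toℕ r) * M r m))
           (cong (product G *_) (det-scaleRows (λ r → fromℕ 4 ^ (2 ℕ.* toℕ r)) M)) ⟩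
    product G * (U * det M)
      ≡⟨ cong₂ (λ u v → u * (U * v))
           (trans (Prod.∑-distrib-+ {suc n} (λ _ → fromℕ 4 ^ (a ℕ.+ b))
               (λ m → γ (a ℕ.∸ toℕ m) * γ (b ℕ.+ toℕ m)))
             (cong (_* Γ) (Prod.sum-replicate (suc n) {fromℕ 4 ^ (a ℕ.+ b)})))
           (trans (det-mixedProduct n A B X) (cong₂ _*_
             (mixedFactor-quadratic n A B (fromℕ a + fromℕ b + + 3 / 2) (offsets-difference (fromℕ a + fromℕ b)))
             (vandermonde-quadratic n (fromℕ a) (fromℕ b)))) ⟩
    4ᴺ * Γ * (U * (d * Λ₂ * (c * Λ₁))) ∎

  constants : (U * c * d) * 4ᴺ ≡ s * fromℕ 4 ^ (suc n ℕ.* (a ℕ.+ b)) * o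
  constants = begin
    (U * c * d) * 4ᴺ
      ≡⟨ cong₂ _*_ (factorTower-constant n)
           (trans (^-assocʳ (fromℕ 4) (a ℕ.+ b) (suc n)) (cong (fromℕ 4 ^_) (ℕ.*-comm (a ℕ.+ b) (suc n)))) ⟩
    s * o * fromℕ 4 ^ (suc n ℕ.* (a ℕ.+ b))
      ≡⟨ solve 3 (λ s o e → s :* o :* e := s :* e :* o) refl s o (fromℕ 4 ^ (suc n ℕ.* (a ℕ.+ b))) ⟩
    s * fromℕ 4 ^ (suc n ℕ.* (a ℕ.+ b)) * o ∎
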